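{- Let $\kappa\leq\lambda$ be infinite cardinals with $\kappa$ regular, and let $\lambda'=\lambda^{<\kappa}$. Then $(\lambda')^{<\kappa}=\lambda'$, and the space ${}^{\kappa}\lambda$ is homeomorphic to ${}^{\kappa}\lambda'$ (both with the bounded topology).
   Context: For a set $A$, ${}^{\kappa}A$ is the set of sequences of elements of $A$ of length $\kappa$, with the bounded topology, generated by the cones $\mathbf{N}_s=\{x\in{}^{\kappa}A\mid s\subseteq x\}$ for $s\in{}^{<\kappa}A=\bigcup_{\alpha<\kappa}{}^{\alpha}A$. $\lambda^{<\kappa}=\sup\{\lambda^{\theta}\mid\theta<\kappa\text{ a cardinal}\}$ (cardinal exponentiation). -}

module Defs where

open import Data.Nat.Base using (ℕ)
open import Data.Product.Base using (Σ; Σ-syntax; ∃-syntax; _×_; _,_; proj₁)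
open import Function.Base using (_∘_)
open import Function.Bundles using (_↣_; _↔_; Inverse)
open import Induction.WellFounded using (WellFounded)
open import Level using (Level; _⊔_; suc)
open import Relation.Binary.Core using (Rel)
open import Relation.Binary.Definitions using (Irrelevant)
open import Relation.Binary.PropositionalEquality.Core using (_≡_)
open import Relation.Binary.Structures using (IsStrictTotalOrder)
open import Relation.Nullary.Negation.Core using (¬_)
open import Relation.Unary using (Pred; _∈_; _⊆_)

-- Ordinals are represented by well-ordered types.  The order is
-- proof-irrelevant so that the segments ↓ a below really are subsets.
record Ordinal (ℓ : Level) : Set (suc ℓ) where
  field
    Carrier            : Set ℓ
    _<_                : Rel Carrier ℓ
    <-irrelevant       : Irrelevant _<_
    isStrictTotalOrder : IsStrictTotalOrder _≡_ _<_
    wellFounded        : WellFounded _<_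

  -- The initial segments ↓ a are, up to isomorphism, the ordinals smaller
  -- than this one.
  ↓ : Carrier → Set ℓ
  ↓ a = Σ[ x ∈ Carrier ] x < a

-- A cardinal is an initial ordinal: one of larger cardinality than each of
-- its proper initial segments.  As ordinals are only given up to
-- isomorphism, equality of cardinals is equinumerosity.
record Cardinal (ℓ : Level) : Set (suc ℓ) where
  field
    ordinal : Ordinal ℓ
  open Ordinal ordinal public
  field
    initial : ∀ a → ¬ (Carrier ↣ ↓ a)

∣_∣ : ∀ {ℓ} → Cardinal ℓ → Set ℓ
∣_∣ = Cardinal.Carrier

infix 4 _≤ᶜ_ _<ᶜ_

_≤ᶜ_ : ∀ {ℓ} → Cardinal ℓ → Cardinal ℓ → Set ℓ
κ ≤ᶜ μ = ∣ κ ∣ ↣ ∣ μ ∣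

_<ᶜ_ : ∀ {ℓ} → Cardinal ℓ → Cardinal ℓ → Set ℓ
κ <ᶜ μ = κ ≤ᶜ μ × ¬ (μ ≤ᶜ κ)

Infinite : ∀ {ℓ} → Cardinal ℓ → Set ℓ
Infinite κ = ℕ ↣ ∣ κ ∣

module _ {ℓ} (κ : Cardinal ℓ) where
  open Cardinal κ using (_<_; ↓)

  Cofinal : {A : Set ℓ} → (A → ∣ κ ∣) → Set ℓ
  Cofinal f = ∀ b → ∃[ x ] ¬ (f x < b)

  -- cof(κ) = κ: no ordinal below κ maps cofinally into κ.
  Regular : Set ℓ
  Regular = ∀ a (f : ↓ a → ∣ κ ∣) → ¬ Cofinal f

-- μ is the supremum of the cardinalities of the types F i, where
-- |A| ≤ ν means that A injects into ν.
IsSup : ∀ {i ℓ} {I : Set i} → (I → Set ℓ) → Cardinal ℓ → Set (i ⊔ suc ℓ)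
IsSup {ℓ = ℓ} F μ =
  (∀ i → F i ↣ ∣ μ ∣) ×
  ((ν : Cardinal ℓ) → (∀ i → F i ↣ ∣ ν ∣) → μ ≤ᶜ ν)

-- IsWeakPower Λ κ μ says that μ = Λ^{<κ}; the cardinal Λ^θ is the
-- cardinality of the function type ∣ θ ∣ → ∣ Λ ∣.
IsWeakPower : ∀ {ℓ} → Cardinal ℓ → Cardinal ℓ → Cardinal ℓ → Set (suc ℓ)
IsWeakPower {ℓ} Λ κ μ = IsSup F μ
  where
  F : (Σ[ θ ∈ Cardinal ℓ ] θ <ᶜ κ) → Set ℓ
  F i = ∣ proj₁ i ∣ → ∣ Λ ∣

-- A topology is given by its collection of open sets.
Opens : ∀ {ℓ} → Set ℓ → Set (suc ℓ)
Opens {ℓ} X = Pred (Pred X ℓ) ℓ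

generatedByBasis : ∀ {ℓ} {X I : Set ℓ} → (I → Pred X ℓ) → Opens X
generatedByBasis B U = ∀ x → x ∈ U → ∃[ i ] (x ∈ B i × B i ⊆ U)

Continuous : ∀ {ℓ} {X Y : Set ℓ} → Opens X → Opens Y → (X → Y) → Set (suc ℓ)
Continuous {ℓ} {Y = Y} σ τ f = (U : Pred Y ℓ) → τ U → σ (U ∘ f)

Homeomorphic : ∀ {ℓ} {X Y : Set ℓ} → Opens X → Opens Y → Set (suc ℓ)
Homeomorphic {X = X} {Y} σ τ =
  Σ[ h ∈ X ↔ Y ]
    Continuous σ τ (Inverse.to h) × Continuous τ σ (Inverse.from h)

module _ {ℓ} (κ : Cardinal ℓ) (A : Set ℓ) where
  open Cardinal κ using (↓)

  Sequence : Set ℓ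
  Sequence = ∣ κ ∣ → A

  ShortSequence : Set ℓ
  ShortSequence = Σ[ α ∈ ∣ κ ∣ ] (↓ α → A)

  Cone : ShortSequence → Pred Sequence ℓ
  Cone (α , s) x = ∀ i → x (proj₁ i) ≡ s i

  -- Two cones are disjoint or one contains the other and, κ being nonempty in
  -- all cases of interest, the empty sequence gives the whole space, so the
  -- cones form a basis.
  boundedTopology : Opens Sequence
  boundedTopology = generatedByBasis Cone

{-# OPTIONS --safe #-}
module Submission where

-- Excluded middle decides every type of level ℓ, so it also chooses elements:
-- this gives choice, hence Zermelo's theorem and cardinalities.
--
-- Call a set small if it injects into a proper initial segment of κ; by
-- regularity small sets are closed under small sums.  A set N bounds L^{<κ} if
-- it receives an injection from every L^A with A small.  The κ-sum of powers
-- L^{B a} with all B a small injects into every such N, so the set of blocks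
-- (l , s), with s of length |l|, has cardinality L^{<κ}; here |g a| = a for a
-- fixed g : κ ↣ L.
--
-- For the homeomorphism let Y = ^κ L.  A sequence starts with exactly one
-- block, so Y ≅ Block × Y, and κ × κ ↔ κ gives Y ≅ ^κ Y.  Therefore
-- Y ≅ ^κ(Block × Y) ≅ ^κ Block × ^κ Y ≅ ^κ Block × Y ≅ ^κ(Block × L), where
-- Block × L also has cardinality L^{<κ}.  For regular κ the bounded topology
-- can be generated by small sets of coordinates instead of initial segments,
-- so it does not depend on how the coordinates are ordered.

open import Defs
open import Axiom.ExcludedMiddle using (ExcludedMiddle)
open import Axiom.Extensionality.Propositional
  using (Extensionality; implicit-extensionality; lower-extensionality)
open import Axiom.UniquenessOfIdentityProofs.WithK using (uip)
open import Data.Bool.Base using (Bool; true; false)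
open import Data.Bool.Properties using (T-irrelevant)
open import Data.Product.Base using (Σ; Σ-syntax; ∃; ∃-syntax; _×_; _,_; proj₁; proj₂)
open import Data.Product.Properties using (,-injectiveˡ; ,-injectiveʳ; ,-injectiveʳ-UIP; ×-≡,≡→≡)
open import Data.Product.Relation.Binary.Lex.Strict using (×-Lex; ×-wellFounded)
open import Data.Sum.Base as Sum using (_⊎_; inj₁; inj₂; [_,_]; [_,_]′)
open import Data.Unit.Polymorphic.Base using (⊤; tt)
open import Function.Base using (_∘_; _on_; const; id)
open import Function.Bundles using (_↣_; _↔_; mk↣; mk⤖; mk↔ₛ′; Injection; Inverse)
open import Function.Construct.Composition
  using (_↔-∘_) renaming (_↣-∘_ to infixr 9 _⊚_)
open import Function.Construct.Identity using (↣-id)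
open import Function.Properties.Bijection using (⤖⇒↔)
open import Induction.WellFounded
  using (Acc; acc; WellFounded; WfRec; wf⇒asym; module All; module FixPoint; module Subrelation)
open import Level using (Level; _⊔_; suc; Lift; lift; lower)
open import Relation.Binary.Construct.On as On using ()
open import Relation.Binary.Core using (Rel)
open import Relation.Binary.Definitions using (Asymmetric; Trichotomous; tri<; tri≈; tri>)
open import Relation.Binary.PropositionalEquality
  using (_≡_; _≢_; refl; sym; trans; cong; cong₂; subst; isEquivalence; resp₂)
open import Relation.Binary.Structures using (IsStrictTotalOrder)
open import Relation.Nullary.Decidable.Core
  using (True; yes; no; isYes; toWitness; fromWitness; decidable-stable)
open import Relation.Nullary.Negation.Core using (¬_; contradiction)

open Injection using (injective) renaming (to to ⟦_⟧)
open Ordinal using (Carrier)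

Connected : ∀ {a r} {A : Set a} → Rel A r → Set _
Connected _<_ = ∀ {x y} → x ≢ y → x < y ⊎ y < x

-- The orbits of A under g ∘ f that start outside the image of g.
data Chain {a b} {A : Set a} {B : Set b} (f : A → B) (g : B → A) : A → Set (a ⊔ b) where
  root : ∀ {x} → (∀ b → g b ≢ x) → Chain f g x
  climb : ∀ {x y} → Chain f g x → g (f x) ≡ y → Chain f g y

module Classical {ℓ : Level} (em : ExcludedMiddle ℓ) (ext : Extensionality ℓ ℓ) where

  -- Classical logic and well-orders

  dne : {P : Set ℓ} → ¬ ¬ P → P
  dne = decidable-stable em

  ¬∀¬⇒∃ : {A : Set ℓ} {P : A → Set ℓ} → ¬ (∀ x → ¬ P x) → ∃ P
  ¬∀¬⇒∃ h = dne λ ¬e → h λ x p → ¬e (x , p)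

  ¬∀⇒∃¬ : {A : Set ℓ} {P : A → Set ℓ} → ¬ (∀ x → P x) → ∃[ x ] ¬ P x
  ¬∀⇒∃¬ h = dne λ ¬e → h λ x → dne λ ¬p → ¬e (x , ¬p)

  module _ {A : Set ℓ} {_<_ : Rel A ℓ} (wf : WellFounded _<_) (conn : Connected _<_) where

    -- A well-founded relation has no cycles of length 2 or 3, so for `x < y` and `y < z`
    -- connectedness leaves only `x < z`.
    wellFounded-connected⇒strictTotal : IsStrictTotalOrder _≡_ _<_
    wellFounded-connected⇒strictTotal = record
      { isStrictPartialOrder = record
        { isEquivalence = isEquivalence
        ; irrefl = λ { refl x<x → asym x<x x<x }
        ; trans = λ {x} {y} {z} → transitive x y z
        ; <-resp-≈ = resp₂ _<_
        }
      ; compare = compare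
      }
      where
      asym : Asymmetric _<_
      asym = wf⇒asym wf

      no-3-cycle : ∀ {x y z} → Acc _<_ x → x < y → y < z → ¬ z < x
      no-3-cycle (acc rs) x<y y<z z<x = no-3-cycle (rs z<x) z<x x<y y<z

      transitive : ∀ x y z → x < y → y < z → x < z
      transitive x y z x<y y<z with em {x ≡ z}
      ... | yes refl = contradiction y<z (asym x<y)
      ... | no x≢z with conn x≢z
      ... | inj₁ x<z = x<z
      ... | inj₂ z<x = contradiction z<x (no-3-cycle (wf x) x<y y<z)

      compare : Trichotomous _≡_ _<_
      compare x y with em {x ≡ y}
      ... | yes refl = tri≈ (λ x<x → asym x<x x<x) refl (λ x<x → asym x<x x<x)
      ... | no x≢y with conn x≢y
      ... | inj₁ x<y = tri< x<y x≢y (asym x<y)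
      ... | inj₂ y<x = tri> (asym y<x) x≢y y<x

  -- Passing to the truth value of x < y makes the order proof-irrelevant.
  wellOrder : (A : Set ℓ) (_<_ : Rel A ℓ) → WellFounded _<_ → Connected _<_ → Ordinal ℓ
  wellOrder A _<_ wf conn = record
    { Carrier = A
    ; _<_ = λ x y → Lift ℓ (True (em {x < y}))
    ; <-irrelevant = λ { (lift p) (lift q) → cong lift (T-irrelevant p q) }
    ; isStrictTotalOrder = wellFounded-connected⇒strictTotal wf′
        λ x≢y → Sum.map (lift ∘ fromWitness) (lift ∘ fromWitness) (conn x≢y)
    ; wellFounded = wf′
    }
    where
    wf′ : WellFounded (λ x y → Lift ℓ (True (em {x < y})))
    wf′ = Subrelation.wellFounded (toWitness ∘ lower) wf

  ordinal-connected : (o : Ordinal ℓ) → Connected (Ordinal._<_ o)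
  ordinal-connected o {x} {y} x≢y with IsStrictTotalOrder.compare (Ordinal.isStrictTotalOrder o) x y
  ... | tri< x<y _ _ = inj₁ x<y
  ... | tri≈ _ x≡y _ = contradiction x≡y x≢y
  ... | tri> _ _ y<x = inj₂ y<x

  restrict : {A : Set ℓ} (o : Ordinal ℓ) → A ↣ Carrier o → Ordinal ℓ
  restrict {A} o j = wellOrder A (Ordinal._<_ o on ⟦ j ⟧)
    (On.wellFounded ⟦ j ⟧ (Ordinal.wellFounded o))
    (λ x≢y → ordinal-connected o (x≢y ∘ injective j))

  least : (o : Ordinal ℓ) (P : Carrier o → Set ℓ) → ∃ P →
          ∃[ x ] (P x × ∀ {y} → Ordinal._<_ o y x → ¬ P y)
  least o P (x , p) = go x (Ordinal.wellFounded o x) p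
    where
    open Ordinal o using (_<_)
    go : ∀ x → Acc _<_ x → P x → ∃[ x ] (P x × ∀ {y} → y < x → ¬ P y)
    go x (acc rs) p with em {∃[ y ] (y < x × P y)}
    ... | yes (y , y<x , q) = go y (rs y<x) q
    ... | no none = x , p , λ y<x q → none (_ , y<x , q)

  ↓-injection : (o : Ordinal ℓ) {A : Set ℓ} {a : Carrier o} (f : A → Carrier o) →
                (∀ {x y} → f x ≡ f y → x ≡ y) → (∀ x → Ordinal._<_ o (f x) a) → A ↣ Ordinal.↓ o a
  ↓-injection o f inj f<a = mk↣ {to = λ x → f x , f<a x} (inj ∘ cong proj₁)

  ↓-ext : (o : Ordinal ℓ) {a : Carrier o} {x y : Ordinal.↓ o a} → proj₁ x ≡ proj₁ y → x ≡ y
  ↓-ext o refl = cong (_ ,_) (Ordinal.<-irrelevant o _ _)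

  ↓↣ : (o : Ordinal ℓ) (a : Carrier o) → Ordinal.↓ o a ↣ Carrier o
  ↓↣ o a = mk↣ {to = proj₁} (↓-ext o)

  -- Transfinite recursion: x is sent to a value not taken below x.
  embed : (o : Ordinal ℓ) (Y : Set ℓ) → (∀ x → ¬ (Y ↣ Ordinal.↓ o x)) → Carrier o ↣ Y
  embed o Y h = mk↣ f-injective
    where
    open Ordinal o using (_<_; ↓; wellFounded)

    Fresh : ∀ x → WfRec _<_ (λ _ → Y) x → Set ℓ
    Fresh x rec = Σ[ y ∈ Y ] ∀ ((_ , x′<x) : ↓ x) → rec x′<x ≢ y

    fresh : ∀ x (rec : WfRec _<_ (λ _ → Y) x) → Fresh x rec
    -- If every `y` were already taken below `x`, choosing a preimage of each would inject `Y` into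
    -- `↓ x`.
    fresh x rec = dne λ none →
      let hit : ∀ y → Σ[ (_ , x′<x) ∈ ↓ x ] rec x′<x ≡ y
          hit y = ¬∀¬⇒∃ λ miss → none (y , miss)
      in h x (mk↣ {to = proj₁ ∘ hit} λ {y} {y′} e →
           trans (sym (proj₂ (hit y))) (trans (cong (λ (_ , p) → rec p) e) (proj₂ (hit y′))))

    step : ∀ x → WfRec _<_ (λ _ → Y) x → Y
    step x rec = proj₁ (fresh x rec)

    open FixPoint wellFounded (λ _ → Y) step
      (λ x e → cong (step x) (implicit-extensionality ext (ext e)))

    f : Carrier o → Y
    f = All.wfRec wellFounded ℓ (λ _ → Y) step

    f-fresh : ∀ {x x′} → x′ < x → f x′ ≢ f x
    f-fresh {x} x′<x e =
      proj₂ (fresh x (λ {y} _ → f y)) (_ , x′<x) (trans e (unfold-wfRec {x}))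

    f-injective : ∀ {x y} → f x ≡ f y → x ≡ y
    f-injective e = dne λ x≢y → [ (λ x<y → f-fresh x<y e) , (λ y<x → f-fresh y<x (sym e)) ]′
      (ordinal-connected o x≢y)

  -- Injections of function spaces and the Cantor-Bernstein theorem

  extend : {A B C : Set ℓ} → A ↣ B → C → (A → C) → B → C
  extend {A} j c f b with em {Σ[ a ∈ A ] ⟦ j ⟧ a ≡ b}
  ... | yes (a , _) = f a
  ... | no _ = c

  extend-to : {A B C : Set ℓ} (j : A ↣ B) (c : C) (f : A → C) → ∀ a → extend j c f (⟦ j ⟧ a) ≡ f a
  extend-to {A} j c f a with em {Σ[ a′ ∈ A ] ⟦ j ⟧ a′ ≡ ⟦ j ⟧ a}
  ... | yes (_ , e) = cong f (injective j e)
  ... | no none = contradiction (a , refl) none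

  →-mono : {A B C : Set ℓ} → A ↣ B → C → (A → C) ↣ (B → C)
  →-mono j c = mk↣ {to = extend j c} λ {f} {g} e → ext λ a →
    trans (sym (extend-to j c f a)) (trans (cong (λ h → h (⟦ j ⟧ a)) e) (extend-to j c g a))

  ∘-mono : {A B C : Set ℓ} → B ↣ C → (A → B) ↣ (A → C)
  ∘-mono j = mk↣ {to = ⟦ j ⟧ ∘_} λ e → ext λ a → injective j (cong (λ h → h a) e)

  cantor-bernstein : {A B : Set ℓ} → A ↣ B → B ↣ A → A ↔ B
  cantor-bernstein {A} {B} f g = ⤖⇒↔ (mk⤖ {to = k} (k-injective _ _ , k-surjective))
    where
    -- The graph of the bijection: `f` on the chains, the inverse of `g` elsewhere. A point on no
    -- chain is in particular no root, so it has a preimage under `g`.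
    Image : A → B → Set ℓ
    Image x b = (Chain ⟦ f ⟧ ⟦ g ⟧ x × ⟦ f ⟧ x ≡ b) ⊎ (¬ Chain ⟦ f ⟧ ⟦ g ⟧ x × ⟦ g ⟧ b ≡ x)

    image : ∀ x → ∃ (Image x)
    image x with em {Chain ⟦ f ⟧ ⟦ g ⟧ x}
    ... | yes c = ⟦ f ⟧ x , inj₁ (c , refl)
    ... | no ¬c = let b , e = ¬∀¬⇒∃ (¬c ∘ root) in b , inj₂ (¬c , e)

    k : A → B
    k = proj₁ ∘ image

    image-injective : ∀ {x y b} → Image x b → Image y b → x ≡ y
    image-injective (inj₁ (_ , p)) (inj₁ (_ , q)) = injective f (trans p (sym q))
    image-injective (inj₁ (c , refl)) (inj₂ (¬d , q)) = contradiction (climb c q) ¬d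
    image-injective (inj₂ (¬d , q)) (inj₁ (c , refl)) = contradiction (climb c q) ¬d
    image-injective (inj₂ (_ , p)) (inj₂ (_ , q)) = trans (sym p) q

    k-injective : ∀ x y → k x ≡ k y → x ≡ y
    k-injective x y e = image-injective (subst (Image x) e (proj₂ (image x))) (proj₂ (image y))

    image-functional : ∀ {x b b′} → Image x b → Image x b′ → b ≡ b′
    image-functional (inj₁ (_ , p)) (inj₁ (_ , q)) = trans (sym p) q
    image-functional (inj₁ (c , _)) (inj₂ (¬c , _)) = contradiction c ¬c
    image-functional (inj₂ (¬c , _)) (inj₁ (c , _)) = contradiction c ¬c
    image-functional (inj₂ (_ , p)) (inj₂ (_ , q)) = injective g (trans p (sym q))

    preimage : ∀ b → Σ[ x ∈ A ] Image x b
    preimage b with em {Chain ⟦ f ⟧ ⟦ g ⟧ (⟦ g ⟧ b)}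
    ... | no ¬c = ⟦ g ⟧ b , inj₂ (¬c , refl)
    -- `⟦ g ⟧ b` cannot be a root, so its chain climbs there from some `x`, and then `⟦ f ⟧ x ≡ b`.
    ... | yes (root h) = contradiction refl (h b)
    ... | yes (climb {x} c e) = x , inj₁ (c , injective g e)

    k-surjective : ∀ b → Σ[ x ∈ A ] (∀ {z} → z ≡ x → k z ≡ b)
    k-surjective b = let x , i = preimage b in
      x , λ { refl → image-functional (proj₂ (image x)) i }

  -- Zermelo's theorem

  module Zermelo (A : Set ℓ) (a₀ : A) where

    -- Characteristic functions keep subsets at level `ℓ`, where excluded middle applies, and make
    -- mutually included subsets equal, so that `pick` treats them alike.
    Subset : Set ℓ
    Subset = A → Bool

    infix 4 _∈_ _∉_ _⊆_

    _∈_ _∉_ : A → Subset → Set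
    x ∈ S = S x ≡ true
    x ∉ S = ¬ x ∈ S

    _⊆_ : Subset → Subset → Set ℓ
    S ⊆ R = ∀ x → x ∈ S → x ∈ R

    ⊆-trans : ∀ {S R Q} → S ⊆ R → R ⊆ Q → S ⊆ Q
    ⊆-trans S⊆R R⊆Q x = R⊆Q x ∘ S⊆R x

    ⊆-antisym : ∀ {S R} → S ⊆ R → R ⊆ S → S ≡ R
    ⊆-antisym {S} {R} S⊆R R⊆S = lower-extensionality ℓ ℓ ext pointwise
      where
      pointwise : ∀ x → S x ≡ R x
      pointwise x with S x in p | R x in q
      ... | true | true = refl
      ... | false | false = refl
      ... | true | false with () ← trans (sym q) (S⊆R x p)
      ... | false | true with () ← trans (sym p) (R⊆S x q)

    -- Abstract, so that P can be inferred from ⟪ P ⟫ x.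
    abstract
      ⟪_⟫ : ∀ {X : Set ℓ} → (X → Set ℓ) → X → Bool
      ⟪ P ⟫ x = isYes (em {P x})

      ∈⟪⟫⁺ : ∀ {X : Set ℓ} {P : X → Set ℓ} {x} → P x → ⟪ P ⟫ x ≡ true
      ∈⟪⟫⁺ {P = P} {x} p with em {P x}
      ... | yes _ = refl
      ... | no ¬p = contradiction p ¬p

      ∈⟪⟫⁻ : ∀ {X : Set ℓ} {P : X → Set ℓ} {x} → ⟪ P ⟫ x ≡ true → P x
      ∈⟪⟫⁻ {P = P} {x} e with em {P x}
      ... | yes p = p

    -- Chooses an element outside S; the junk value a₀ occurs only if S is everything.
    pick : Subset → A
    pick S with em {Σ[ x ∈ A ] x ∉ S}
    ... | yes (x , _) = x
    ... | no _ = a₀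

    pick-∉ : ∀ S {x} → x ∉ S → pick S ∉ S
    pick-∉ S x∉S with em {Σ[ x ∈ A ] x ∉ S}
    ... | yes (_ , p∉S) = p∉S
    ... | no none = contradiction (_ , x∉S) none

    next : Subset → Subset
    next S = ⟪ (λ x → x ∈ S ⊎ x ≡ pick S) ⟫

    ⊆next : ∀ {S} → S ⊆ next S
    ⊆next _ = ∈⟪⟫⁺ ∘ inj₁

    pick∈next : ∀ S → pick S ∈ next S
    pick∈next S = ∈⟪⟫⁺ (inj₂ refl)

    ⋃ : (Subset → Bool) → Subset
    ⋃ F = ⟪ (λ x → Σ[ S ∈ Subset ] (F S ≡ true × x ∈ S)) ⟫

    ⊆⋃ : ∀ {F S} → F S ≡ true → S ⊆ ⋃ F
    ⊆⋃ S∈F _ x∈S = ∈⟪⟫⁺ (_ , S∈F , x∈S)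

    ⋃⊆ : ∀ {F R} → (∀ S → F S ≡ true → S ⊆ R) → ⋃ F ⊆ R
    ⋃⊆ h x x∈⋃ = let S , S∈F , x∈S = ∈⟪⟫⁻ x∈⋃ in h S S∈F x x∈S

    -- The base of the tower, the empty set, is the `limit` of the empty family.
    data Tower : Subset → Set ℓ where
      successor : ∀ {S} → Tower S → Tower (next S)
      limit : ∀ F → (∀ S → F S ≡ true → Tower S) → Tower (⋃ F)

    Comparable : Subset → Set ℓ
    Comparable S = ∀ {R} → Tower R → R ⊆ S ⊎ S ⊆ R

    next-comparable : ∀ {S} → Comparable S → ∀ {R} → Tower R → R ⊆ S ⊎ next S ⊆ R
    next-comparable {S} cS (successor {R} tR) with next-comparable cS tR | cS (successor tR)
    ... | inj₂ nS⊆R | _ = inj₂ (⊆-trans nS⊆R ⊆next)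
    ... | inj₁ _ | inj₁ nR⊆S = inj₁ nR⊆S
    -- `S` lies between `R` and `next R`, which differ at most by `pick R`; whether `S` contains
    -- this point decides which of them it equals.
    ... | inj₁ R⊆S | inj₂ S⊆nR with em {Lift ℓ (pick R ∈ S)}
    ... | yes (lift p∈S) = inj₁ λ x x∈nR → [ R⊆S x , (λ { refl → p∈S }) ]′ (∈⟪⟫⁻ x∈nR)
    ... | no p∉S = inj₂ (subst (λ S → next S ⊆ next R) (⊆-antisym R⊆S S⊆R) (λ _ → id))
      where
      S⊆R : S ⊆ R
      S⊆R x x∈S = [ id , (λ { refl → contradiction (lift x∈S) p∉S }) ]′ (∈⟪⟫⁻ (S⊆nR x x∈S))
    next-comparable {S} cS (limit F tF) with em {Σ[ R ∈ Subset ] (F R ≡ true × next S ⊆ R)}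
    ... | yes (R , R∈F , nS⊆R) = inj₂ (⊆-trans nS⊆R (⊆⋃ R∈F))
    ... | no none = inj₁ (⋃⊆ λ R R∈F →
        [ id , (λ nS⊆R → contradiction (R , R∈F , nS⊆R) none) ]′ (next-comparable cS (tF R R∈F)))

    comparable : ∀ {S} → Tower S → Comparable S
    comparable (successor tS) tR =
      Sum.map (λ R⊆S → ⊆-trans R⊆S ⊆next) id (next-comparable (comparable tS) tR)
    comparable (limit F tF) {R} tR with em {Σ[ S ∈ Subset ] (F S ≡ true × R ⊆ S)}
    ... | yes (S , S∈F , R⊆S) = inj₁ (⊆-trans R⊆S (⊆⋃ S∈F))
    ... | no none = inj₂ (⋃⊆ λ S S∈F →
        [ (λ R⊆S → contradiction (S , S∈F , R⊆S) none) , id ]′ (comparable (tF S S∈F) tR))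

    linear : ∀ {S R} → Tower S → Tower R → R ⊆ S ⊎ next S ⊆ R
    linear tS = next-comparable (comparable tS)

    Avoids : A → Subset → Set ℓ
    Avoids x S = Tower S × Lift ℓ (x ∉ S)

    -- The largest member of the tower that avoids x; x is the point picked next,
    -- and x < y means that x enters the tower before y.
    below : A → Subset
    below x = ⋃ ⟪ Avoids x ⟫

    below-tower : ∀ x → Tower (below x)
    below-tower x = limit _ λ S S∈F → proj₁ (∈⟪⟫⁻ S∈F)

    ∉below : ∀ x → x ∉ below x
    ∉below x x∈ = let S , S∈F , x∈S = ∈⟪⟫⁻ x∈ in lower (proj₂ (∈⟪⟫⁻ S∈F)) x∈S

    avoiding⊆below : ∀ {S x} → Tower S → x ∉ S → S ⊆ below x
    avoiding⊆below tS x∉S = ⊆⋃ (∈⟪⟫⁺ (tS , lift x∉S))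

    -- Otherwise `next (below x)` would avoid `x` as well, against the maximality of `below x`.
    ∈next-below : ∀ x → x ∈ next (below x)
    ∈next-below x with em {Lift ℓ (x ∈ next (below x))}
    ... | yes (lift x∈) = x∈
    ... | no x∉ = contradiction
      (avoiding⊆below (successor (below-tower x)) (x∉ ∘ lift) _ (pick∈next (below x)))
      (pick-∉ (below x) (∉below x))

    pick-below : ∀ x → x ≡ pick (below x)
    pick-below x = [ (λ x∈ → contradiction x∈ (∉below x)) , id ]′ (∈⟪⟫⁻ (∈next-below x))

    _<_ : Rel A ℓ
    x < y = Lift ℓ (x ∈ below y)

    -- By `pick-below` a point is determined by its stage. Of two different stages the larger
    -- contains the successor of the smaller, hence also the point of the smaller.
    <-connected : Connected _<_
    <-connected {x} {y} x≢y
      with linear (below-tower y) (below-tower x) | linear (below-tower x) (below-tower y)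
    ... | inj₂ ny⊆x | _ = inj₂ (lift (ny⊆x y (∈next-below y)))
    ... | inj₁ _ | inj₂ nx⊆y = inj₁ (lift (nx⊆y x (∈next-below x)))
    ... | inj₁ x⊆y | inj₁ y⊆x = contradiction
      (trans (pick-below x) (trans (cong pick (⊆-antisym x⊆y y⊆x)) (sym (pick-below y)))) x≢y

    -- Induction on the stage: the point that enters at `next S` has all its predecessors in `S`.
    tower-accessible : ∀ {S} → Tower S → ∀ {x} → x ∈ S → Acc _<_ x
    tower-accessible (successor {S} tS) {x} x∈nS with ∈⟪⟫⁻ x∈nS
    ... | inj₁ x∈S = tower-accessible tS x∈S
    ... | inj₂ refl with linear tS (below-tower x)
    ... | inj₁ below⊆S = acc λ (lift y∈) → tower-accessible tS (below⊆S _ y∈)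
    ... | inj₂ nS⊆below = contradiction (nS⊆below x x∈nS) (∉below x)
    tower-accessible (limit F tF) x∈⋃ =
      let S , S∈F , x∈S = ∈⟪⟫⁻ x∈⋃ in tower-accessible (tF S S∈F) x∈S

    <-wellFounded : WellFounded _<_
    <-wellFounded x = tower-accessible (successor (below-tower x)) (∈next-below x)

  zermelo : Set ℓ → Ordinal ℓ
  zermelo A = wellOrder A (proj₁ order) (proj₁ (proj₂ order)) (proj₂ (proj₂ order))
    where
    order : Σ[ _<_ ∈ Rel A ℓ ] (WellFounded _<_ × Connected _<_)
    order with em {A}
    ... | yes a₀ = Zermelo._<_ A a₀ , Zermelo.<-wellFounded A a₀ , Zermelo.<-connected A a₀
    -- On an empty type any relation is a well-order.
    ... | no ¬a = (λ _ _ → Lift ℓ Bool) , (λ a → contradiction a ¬a) , (λ {a} _ → contradiction a ¬a)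

  -- Cardinalities

  Equinumerous : Set ℓ → Set ℓ → Set ℓ
  Equinumerous A B = (A ↣ B) × (B ↣ A)

  cardinality : (A : Set ℓ) → Σ[ μ ∈ Cardinal ℓ ] Equinumerous A ∣ μ ∣
  cardinality A with em {Σ[ a ∈ A ] (A ↣ Ordinal.↓ (zermelo A) a)}
  ... | no none = record { ordinal = zermelo A ; initial = λ a j → none (a , j) } ,
    ↣-id _ , ↣-id _
  -- The least segment that receives `A` is equinumerous with `A`; if it injected into a segment of
  -- its own, that smaller segment would receive `A` too.
  ... | yes small = let a , j , minimal = least (zermelo A) _ small in
    record
      { ordinal = restrict (zermelo A) (fst↣ a)
      ; initial = λ b i → minimal (proj₂ b) (↓↓ b ⊚ i ⊚ j)
      } , j , fst↣ a
    where
    open Ordinal (zermelo A) using (↓)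
    fst↣ : ∀ a → ↓ a ↣ A
    fst↣ = ↓↣ (zermelo A)
    ↓↓ : ∀ {a} (b : ↓ a) → Ordinal.↓ (restrict (zermelo A) (fst↣ a)) b ↣ ↓ (proj₁ b)
    ↓↓ {a} b = mk↣ {to = λ x → proj₁ (proj₁ x) , toWitness (lower (proj₂ x))}
      λ {x} {y} e → ↓-ext (restrict (zermelo A) (fst↣ a)) {b} {x} {y} (↓-ext (zermelo A) (cong proj₁ e))

  Σ-map↣ : {A : Set ℓ} {B C : A → Set ℓ} → (∀ x → B x ↣ C x) → Σ A B ↣ Σ A C
  Σ-map↣ j = mk↣ {to = λ (x , b) → x , ⟦ j x ⟧ b} inj
    where
    inj : ∀ {u v} → (proj₁ u , ⟦ j (proj₁ u) ⟧ (proj₂ u)) ≡ (proj₁ v , ⟦ j (proj₁ v) ⟧ (proj₂ v)) → u ≡ v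
    inj {x , _} e with refl ← ,-injectiveˡ e = cong (x ,_) (injective (j x) (,-injectiveʳ-UIP uip e))

  module _ {L : Set ℓ} where

    cons↣ : {X A : Set ℓ} → X ↣ L → (X × (A → L)) ↣ (⊤ {ℓ} ⊎ A → L)
    cons↣ j = mk↣ {to = λ (x , f) → [ const (⟦ j ⟧ x) , f ]′} λ e →
      ×-≡,≡→≡ (injective j (cong (λ f → f (inj₁ tt)) e) , cong (_∘ inj₂) e)

    -- The component `x` is kept, because the function extended by `l` need not reveal from which
    -- fibre it came.
    uncurry↣ : {X : Set ℓ} {B : X → Set ℓ} → L → Σ X (λ x → B x → L) ↣ (X × (Σ X B → L))
    uncurry↣ {X} {B} l = Σ-map↣ λ x → →-mono {B = Σ X B} (mk↣ {to = x ,_} (,-injectiveʳ-UIP uip)) l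

  -- Small sets

  module Regularity (κ : Cardinal ℓ) (infinite : Infinite κ) (regular : Regular κ) where
    open Cardinal κ using (_<_; ↓; ordinal; initial; wellFounded)

    Small : Set ℓ → Set ℓ
    Small A = ∃[ a ] (A ↣ ↓ a)

    ¬small⇒↣ : {A : Set ℓ} → ¬ Small A → ∣ κ ∣ ↣ A
    ¬small⇒↣ {A} ¬s = embed ordinal A λ a j → ¬s (a , j)

    small⇒¬↣ : {A : Set ℓ} → Small A → ¬ (∣ κ ∣ ↣ A)
    small⇒¬↣ (a , j) i = initial a (j ⊚ i)

    small-↣ : {A B : Set ℓ} → A ↣ B → Small B → Small A
    small-↣ i (a , j) = a , j ⊚ i

    <-irrefl : ∀ {a} → ¬ a < a
    <-irrefl a<a = wf⇒asym wellFounded a<a a<a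

    <-trans : ∀ {a b c} → a < b → b < c → a < c
    <-trans = IsStrictTotalOrder.trans (Cardinal.isStrictTotalOrder κ)

    zero′ one′ : ∣ κ ∣
    zero′ = ⟦ infinite ⟧ 0
    one′ = ⟦ infinite ⟧ 1

    -- Regularity concerns maps defined on a whole segment, so `f` is first extended from `A` to
    -- `↓ a` with the default `zero′`; a strict bound of the extension also bounds `f`.
    bounded : {A : Set ℓ} → Small A → (f : A → ∣ κ ∣) → ∃[ b ] ∀ x → f x < b
    bounded (a , j) f =
      let b , below = ¬∀⇒∃¬ (regular a (extend j zero′ f)) in
      b , λ x → subst (_< b) (extend-to j zero′ f x) (dne λ ≮b → below (⟦ j ⟧ x , ≮b))

    zero≢one : zero′ ≢ one′
    zero≢one e with () ← injective infinite e

    small-⊤ : Small ⊤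
    small-⊤ with ordinal-connected ordinal zero≢one
    ... | inj₁ 0<1 = one′ , mk↣ {to = λ _ → zero′ , 0<1} λ _ → refl
    ... | inj₂ 1<0 = zero′ , mk↣ {to = λ _ → one′ , 1<0} λ _ → refl

    -- By regularity a map from a one-point set is not cofinal, so `κ` is a limit.
    unbounded : ∀ a → ∃[ b ] a < b
    unbounded a = let b , a<b = bounded small-⊤ (const a) in b , a<b tt

    small-↓ : ∀ a → Small (↓ a)
    small-↓ a = a , ↣-id _

    -- If κ ↣ Σ A B, then the fibres over A are bounded, by a common β, but β is in a fibre.
    small-Σ : {A : Set ℓ} {B : A → Set ℓ} → Small A → (∀ a → Small (B a)) → Small (Σ A B)
    small-Σ {A} {B} sA sB = dne λ ¬s →
      let m = ¬small⇒↣ ¬s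
          Fibre : A → Set ℓ
          Fibre a = Σ[ x ∈ ∣ κ ∣ ] proj₁ (⟦ m ⟧ x) ≡ a
          sFibre : ∀ a → Small (Fibre a)
          sFibre a = small-↣ (fibre↣ m a) (sB a)
          β , fibre<β = bounded sA (λ a → proj₁ (bounded (sFibre a) proj₁))
          a = proj₁ (⟦ m ⟧ β)
      in <-irrefl (<-trans (proj₂ (bounded (sFibre a) proj₁) (β , refl)) (fibre<β a))
      where
      fibre↣ : (m : ∣ κ ∣ ↣ Σ A B) (a : A) → (Σ[ x ∈ ∣ κ ∣ ] proj₁ (⟦ m ⟧ x) ≡ a) ↣ B a
      fibre↣ m a = mk↣ {to = λ (x , e) → subst B e (proj₂ (⟦ m ⟧ x))} λ {u} {v} → inj {u} {v}
        where
        agree : ∀ {u v : Σ A B} (p : proj₁ u ≡ a) (q : proj₁ v ≡ a) →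
                subst B p (proj₂ u) ≡ subst B q (proj₂ v) → u ≡ v
        agree refl refl refl = refl
        inj : ∀ {u v : Σ[ x ∈ ∣ κ ∣ ] proj₁ (⟦ m ⟧ x) ≡ a} →
              subst B (proj₂ u) (proj₂ (⟦ m ⟧ (proj₁ u))) ≡ subst B (proj₂ v) (proj₂ (⟦ m ⟧ (proj₁ v))) → u ≡ v
        inj {x , p} {y , q} e with refl ← injective m (agree p q e) = cong (x ,_) (uip p q)

    small-two : Small (⊤ {ℓ} ⊎ ⊤ {ℓ})
    small-two =
      let c , 0<c = unbounded zero′
          d , c<d = unbounded c
          f = [ const zero′ , const c ]′
      in d , ↓-injection ordinal f
        (λ { {inj₁ _} {inj₁ _} _ → refl
           ; {inj₁ _} {inj₂ _} e → contradiction (subst (_< c) e 0<c) <-irrefl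
           ; {inj₂ _} {inj₁ _} e → contradiction (subst (_< c) (sym e) 0<c) <-irrefl
           ; {inj₂ _} {inj₂ _} _ → refl })
        [ const (<-trans 0<c c<d) , const c<d ]

    small-⊎ : {A B : Set ℓ} → Small A → Small B → Small (A ⊎ B)
    small-⊎ {A} {B} sA sB = small-↣ sum↣ (small-Σ small-two [ const sA , const sB ])
      where
      sum↣ : (A ⊎ B) ↣ Σ (⊤ ⊎ ⊤) [ const A , const B ]
      sum↣ = mk↣ {to = [ inj₁ tt ,_ , inj₂ tt ,_ ]}
        λ { {inj₁ _} {inj₁ _} refl → refl ; {inj₂ _} {inj₂ _} refl → refl }

    -- Lexicographic sums over `κ`, and the square of `κ`

    lexicographic : (B : ∣ κ ∣ → Set ℓ) (Y : Set ℓ) →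
                    (∀ c → ¬ (Y ↣ Σ (↓ c) (B ∘ proj₁))) → Σ ∣ κ ∣ B ↣ Y
    lexicographic B Y h = embed lex Y λ z j →
      let c , z<c = unbounded (proj₁ z) in h c (segment↣ z<c ⊚ j)
      where
      open Ordinal (zermelo (Σ ∣ κ ∣ B)) using () renaming (_<_ to _<′_)

      -- Ties are broken by a well-order of the whole sum, which avoids comparing elements of
      -- different fibre types.
      _<ₗ_ : Rel (Σ ∣ κ ∣ B) ℓ
      _<ₗ_ = ×-Lex _≡_ _<_ _<′_ on λ z → proj₁ z , z

      <ₗ-connected : Connected _<ₗ_
      <ₗ-connected {x} {y} x≢y with em {proj₁ x ≡ proj₁ y}
      ... | yes e = [ (λ x<y → inj₁ (inj₂ (e , x<y))) , (λ y<x → inj₂ (inj₂ (sym e , y<x))) ]′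
        (ordinal-connected (zermelo (Σ ∣ κ ∣ B)) x≢y)
      ... | no ≢ = [ inj₁ ∘ inj₁ , inj₂ ∘ inj₁ ]′ (ordinal-connected ordinal ≢)

      lex : Ordinal ℓ
      lex = wellOrder (Σ ∣ κ ∣ B) _<ₗ_
        (On.wellFounded (λ z → proj₁ z , z)
          (×-wellFounded wellFounded (Ordinal.wellFounded (zermelo (Σ ∣ κ ∣ B)))))
        <ₗ-connected

      -- Whatever precedes `z` has first coordinate at most `proj₁ z`, hence below `c`.
      segment↣ : ∀ {z c} → proj₁ z < c → Ordinal.↓ lex z ↣ Σ (↓ c) (B ∘ proj₁)
      segment↣ {z} {c} z<c = mk↣ {to = λ (x , x<z) → (proj₁ x , first< (toWitness (lower x<z))) , proj₂ x}
        λ {u} {v} e → ↓-ext lex {z} {u} {v} (cong (λ ((a , _) , b) → a , b) e)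
        where
        first< : ∀ {x} → x <ₗ z → proj₁ x < c
        first< = [ (λ x<z → <-trans x<z z<c) , (λ (e , _) → subst (_< c) (sym e) z<c) ]′

    -- A pair is coded in ↓ c × ↓ c for a common bound c.
    square↣ : (∣ κ ∣ × ∣ κ ∣) ↣ ∣ κ ∣
    square↣ = lexicographic (λ c → ↓ c × ↓ c) ∣ κ ∣
        (λ c → small⇒¬↣ (small-Σ (small-↓ c) λ (a , _) → small-Σ (small-↓ a) λ _ → small-↓ a))
      ⊚ mk↣ {to = λ (a , b) → let c , <c = bounded small-two [ const a , const b ]′ in
          c , (a , <c (inj₁ tt)) , (b , <c (inj₂ tt))}
        (cong λ (_ , (a , _) , (b , _)) → a , b)

    abstract
      ⊎-absorb : {A : Set ℓ} → A ↣ ∣ κ ∣ → (A ⊎ ∣ κ ∣) ↔ ∣ κ ∣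
      ⊎-absorb {A} j = cantor-bernstein (square↣ ⊚ sum↣) (mk↣ {to = inj₂} λ { refl → refl })
        where
        sum↣ : (A ⊎ ∣ κ ∣) ↣ (∣ κ ∣ × ∣ κ ∣)
        sum↣ = mk↣ {to = [ (λ a → zero′ , ⟦ j ⟧ a) , one′ ,_ ]′}
          λ { {inj₁ _} {inj₁ _} e → cong inj₁ (injective j (,-injectiveʳ e))
            ; {inj₁ _} {inj₂ _} e → contradiction (,-injectiveˡ e) zero≢one
            ; {inj₂ _} {inj₁ _} e → contradiction (sym (,-injectiveˡ e)) zero≢one
            ; {inj₂ _} {inj₂ _} e → cong inj₂ (,-injectiveʳ e) }

      square : (∣ κ ∣ × ∣ κ ∣) ↔ ∣ κ ∣
      square = cantor-bernstein square↣ (mk↣ {to = λ a → a , a} ,-injectiveˡ)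

    small-⊤⊎ : {A : Set ℓ} → Small A → Small (⊤ {ℓ} ⊎ A)
    small-⊤⊎ = small-⊎ small-⊤

    -- Weak powers in terms of small sets

    Bound : Set ℓ → Set ℓ → Set (suc ℓ)
    Bound L N = ∀ {A} → Small A → (A → L) ↣ N

    -- With `<ᶜ⇒small` this identifies the small sets, up to equinumerosity, with the cardinals
    -- below `κ`, so bounds can be handled without mentioning cardinals.
    small⇒cardinal : {A : Set ℓ} → Small A → Σ[ θ ∈ Cardinal ℓ ] (θ <ᶜ κ × Equinumerous A ∣ θ ∣)
    small⇒cardinal sA@(a , j) =
      let θ , to , from = cardinality _
      in θ , (↓↣ ordinal a ⊚ j ⊚ from , λ i → small⇒¬↣ sA (from ⊚ i)) , to , from

    <ᶜ⇒small : ∀ θ → θ <ᶜ κ → Small ∣ θ ∣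
    <ᶜ⇒small _ (_ , ≰) = dne (≰ ∘ ¬small⇒↣)

    powers⇒bound : {L N : Set ℓ} → L →
      ((i : Σ[ θ ∈ Cardinal ℓ ] θ <ᶜ κ) → (∣ proj₁ i ∣ → L) ↣ N) → Bound L N
    powers⇒bound l p sA = let θ , θ<κ , to , _ = small⇒cardinal sA in p (θ , θ<κ) ⊚ →-mono to l

    weakPower : {Λ μ : Cardinal ℓ} → ∣ Λ ∣ → Bound ∣ Λ ∣ ∣ μ ∣ →
                (∀ {N} → Bound ∣ Λ ∣ N → ∣ μ ∣ ↣ N) → IsWeakPower Λ κ μ
    weakPower l bound minimal = (λ (θ , θ<κ) → bound (<ᶜ⇒small θ θ<κ)) ,
      λ _ p → minimal (powers⇒bound l p)

    weakPower⇒bound : {Λ μ : Cardinal ℓ} → ∣ Λ ∣ → IsWeakPower Λ κ μ → Bound ∣ Λ ∣ ∣ μ ∣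
    weakPower⇒bound l (upper , _) = powers⇒bound l upper

    -- The supremum is compared with cardinals only, so `N` is replaced by its cardinality.
    weakPower-minimal : {Λ μ : Cardinal ℓ} {N : Set ℓ} → IsWeakPower Λ κ μ → Bound ∣ Λ ∣ N → ∣ μ ∣ ↣ N
    weakPower-minimal {N = N} (_ , least-bound) bound =
      let ν , to , from = cardinality N in
      from ⊚ least-bound ν (λ (θ , θ<κ) → to ⊚ bound (<ᶜ⇒small θ θ<κ))

    -- Spaces and homeomorphisms

    -- x ≈[ i ] y says that x and y agree at the i-th coordinate; the neighbourhoods
    -- of x are the sets of points that agree with x at a small set of coordinates.
    record Space : Set (suc ℓ) where
      field
        Point : Set ℓ
        Index : Set ℓ
        _≈[_]_ : Point → Index → Point → Set ℓ

    open Space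

    -- Continuity for these neighbourhoods. It is tested at one target coordinate at a time, since
    -- small sums of small sets are small.
    LocallyDetermined : (S T : Space) → (Point S → Point T) → Set (suc ℓ)
    LocallyDetermined S T f = ∀ x j → Σ[ D ∈ Set ℓ ] Small D × Σ[ d ∈ (D → Index S) ]
      (∀ y → (∀ i → _≈[_]_ S x (d i) y) → _≈[_]_ T (f x) j (f y))

    infix 4 _≅_

    record _≅_ (S T : Space) : Set (suc ℓ) where
      field
        bijection : Point S ↔ Point T
      open Inverse bijection public using (to; from; strictlyInverseˡ; strictlyInverseʳ)
      field
        to-local : LocallyDetermined S T to
        from-local : LocallyDetermined T S from

    open _≅_

    ∘-local : {S T U : Space} {g : Point T → Point U} {f : Point S → Point T} →
              LocallyDetermined T U g → LocallyDetermined S T f → LocallyDetermined S U (g ∘ f)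
    ∘-local {f = f} g-local f-local x k =
      let D , sD , d , g-det = g-local (f x) k
          inner = λ i → f-local x (d i)
      in Σ D (proj₁ ∘ inner) , small-Σ sD (λ i → proj₁ (proj₂ (inner i))) ,
         (λ (i , j) → proj₁ (proj₂ (proj₂ (inner i))) j) ,
         λ y e → g-det (f y) λ i → proj₂ (proj₂ (proj₂ (inner i))) y λ j → e (i , j)

    ≅-sym : {S T : Space} → S ≅ T → T ≅ S
    ≅-sym h = record
      { bijection = mk↔ₛ′ (from h) (to h) (strictlyInverseʳ h) (strictlyInverseˡ h)
      ; to-local = from-local h
      ; from-local = to-local h
      }

    infixr 2 _≅⟨_⟩_
    infix 3 _∎

    _≅⟨_⟩_ : (S : Space) {T U : Space} → S ≅ T → T ≅ U → S ≅ U
    _≅⟨_⟩_ S {T} {U} h k = record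
      { bijection = bijection k ↔-∘ bijection h
      ; to-local = ∘-local {S} {T} {U} (to-local k) (to-local h)
      ; from-local = ∘-local {U} {T} {S} (from-local h) (from-local k)
      }

    _∎ : (S : Space) → S ≅ S
    S ∎ = record
      { bijection = mk↔ₛ′ id id (λ _ → refl) (λ _ → refl)
      ; to-local = λ x i → ⊤ , small-⊤ , const i , λ _ e → e tt
      ; from-local = λ x i → ⊤ , small-⊤ , const i , λ _ e → e tt
      }

    discrete : Set ℓ → Space
    discrete A = record { Point = A ; Index = ⊤ ; _≈[_]_ = λ x _ y → x ≡ y }

    infixr 5 _⊗_

    _⊗_ : Space → Space → Space
    S ⊗ T = record
      { Point = Point S × Point T
      ; Index = Index S ⊎ Index T
      ; _≈[_]_ = λ (x , x′) i (y , y′) → [ (λ j → _≈[_]_ S x j y) , (λ j → _≈[_]_ T x′ j y′) ]′ i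
      }

    power : Space → Space
    power S = record
      { Point = ∣ κ ∣ → Point S
      ; Index = ∣ κ ∣ × Index S
      ; _≈[_]_ = λ x (i , j) y → _≈[_]_ S (x i) j (y i)
      }

    discrete-cong : {A B : Set ℓ} → A ↔ B → discrete A ≅ discrete B
    discrete-cong h = record
      { bijection = h
      ; to-local = λ _ _ → ⊤ , small-⊤ , id , λ _ e → cong (Inverse.to h) (e tt)
      ; from-local = λ _ _ → ⊤ , small-⊤ , id , λ _ e → cong (Inverse.from h) (e tt)
      }

    discrete-⊗ : {A B : Set ℓ} → discrete A ⊗ discrete B ≅ discrete (A × B)
    discrete-⊗ = record
      { bijection = mk↔ₛ′ id id (λ _ → refl) (λ _ → refl)
      ; to-local = λ _ _ → (⊤ ⊎ ⊤) , small-two , id , λ _ e → cong₂ _,_ (e (inj₁ tt)) (e (inj₂ tt))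
      ; from-local = λ where
          _ (inj₁ _) → ⊤ , small-⊤ , id , λ _ e → cong proj₁ (e tt)
          _ (inj₂ _) → ⊤ , small-⊤ , id , λ _ e → cong proj₂ (e tt)
      }

    ⊗-map-local : {S S′ T T′ : Space} {f : Point S → Point S′} {g : Point T → Point T′} →
              LocallyDetermined S S′ f → LocallyDetermined T T′ g →
              LocallyDetermined (S ⊗ T) (S′ ⊗ T′) (λ (x , y) → f x , g y)
    ⊗-map-local f-local g-local (x , _) (inj₁ j) =
      let D , sD , d , det = f-local x j in D , sD , inj₁ ∘ d , λ (y , _) → det y
    ⊗-map-local f-local g-local (_ , x) (inj₂ j) =
      let D , sD , d , det = g-local x j in D , sD , inj₂ ∘ d , λ (_ , y) → det y

    ⊗-cong : {S S′ T T′ : Space} → S ≅ S′ → T ≅ T′ → S ⊗ T ≅ S′ ⊗ T′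
    ⊗-cong {S} {S′} {T} {T′} h k = record
      { bijection = mk↔ₛ′ (λ (x , y) → to h x , to k y) (λ (x , y) → from h x , from k y)
          (λ (x , y) → cong₂ _,_ (strictlyInverseˡ h x) (strictlyInverseˡ k y))
          (λ (x , y) → cong₂ _,_ (strictlyInverseʳ h x) (strictlyInverseʳ k y))
      ; to-local = ⊗-map-local {S} {S′} {T} {T′} (to-local h) (to-local k)
      ; from-local = ⊗-map-local {S′} {S} {T′} {T} (from-local h) (from-local k)
      }

    power-map-local : {S T : Space} {f : Point S → Point T} → LocallyDetermined S T f →
                      LocallyDetermined (power S) (power T) (f ∘_)
    power-map-local f-local x (i , j) =
      let D , sD , d , det = f-local (x i) j in D , sD , (λ k → i , d k) , λ y → det (y i)

    power-cong : {S T : Space} → S ≅ T → power S ≅ power T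
    power-cong {S} {T} h = record
      { bijection = mk↔ₛ′ (to h ∘_) (from h ∘_)
          (λ x → ext (strictlyInverseˡ h ∘ x)) (λ x → ext (strictlyInverseʳ h ∘ x))
      ; to-local = power-map-local {S} {T} (to-local h)
      ; from-local = power-map-local {T} {S} (from-local h)
      }

    power-⊗ : {S T : Space} → power (S ⊗ T) ≅ power S ⊗ power T
    power-⊗ = record
      { bijection = mk↔ₛ′ (λ x → proj₁ ∘ x , proj₂ ∘ x) (λ (x , y) i → x i , y i)
          (λ _ → refl) (λ _ → refl)
      ; to-local = λ where
          _ (inj₁ (i , j)) → ⊤ , small-⊤ , const (i , inj₁ j) , λ _ e → e tt
          _ (inj₂ (i , j)) → ⊤ , small-⊤ , const (i , inj₂ j) , λ _ e → e tt
      ; from-local = λ where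
          _ (i , inj₁ j) → ⊤ , small-⊤ , const (inj₁ (i , j)) , λ _ e → e tt
          _ (i , inj₂ j) → ⊤ , small-⊤ , const (inj₂ (i , j)) , λ _ e → e tt
      }

    power-power : {S : Space} → power (power S) ≅ power S
    power-power {S} = record
      { bijection = mk↔ₛ′ (λ x i → let a , b = split i in x a b) (λ x a b → x (join (a , b)))
          (λ x → ext λ i → cong x (strictlyInverseˡ′ i))
          (λ x → ext λ a → ext λ b → cong (λ (a , b) → x a b) (strictlyInverseʳ′ (a , b)))
      ; to-local = λ _ (i , j) → ⊤ , small-⊤ , const (proj₁ (split i) , proj₂ (split i) , j) , λ _ e → e tt
      ; from-local = λ _ (a , b , j) → ⊤ , small-⊤ , const (join (a , b) , j) , λ _ e → e tt
      }
      where
      open Inverse square using () renaming (to to join; from to split;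
        strictlyInverseˡ to strictlyInverseˡ′; strictlyInverseʳ to strictlyInverseʳ′)

    -- Coordinates are reindexed along `⊎-absorb`. The first factor may be discrete because a
    -- function on `A` is read off from the coordinates in `A`, and these form a small set.
    split : {A L : Set ℓ} → Small A → A ↣ ∣ κ ∣ →
            power (discrete L) ≅ discrete (A → L) ⊗ power (discrete L)
    split {A} {L} sA j = record
      { bijection = mk↔ₛ′ (λ x → x ∘ to′ ∘ inj₁ , x ∘ to′ ∘ inj₂) (λ (f , x) → [ f , x ]′ ∘ from′)
          (λ (f , x) → cong₂ _,_ (ext λ a → cong [ f , x ]′ (from-to (inj₁ a)))
                                 (ext λ i → cong [ f , x ]′ (from-to (inj₂ i))))
          (λ x → ext λ i → trans (reassemble x (from′ i)) (cong x (to-from i)))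
      ; to-local = λ where
          _ (inj₁ _) → A , sA , (λ a → to′ (inj₁ a) , tt) , λ _ e → ext e
          _ (inj₂ (i , _)) → ⊤ , small-⊤ , const (to′ (inj₂ i) , tt) , λ _ e → e tt
      ; from-local = λ (f , x) (i , _) → value-local f x (from′ i)
      }
      where
      open Inverse (⊎-absorb j) using ()
        renaming (to to to′; from to from′; strictlyInverseˡ to to-from; strictlyInverseʳ to from-to)

      reassemble : ∀ x c → [ x ∘ to′ ∘ inj₁ , x ∘ to′ ∘ inj₂ ]′ c ≡ x (to′ c)
      reassemble x (inj₁ _) = refl
      reassemble x (inj₂ _) = refl

      value-local : ∀ (f : A → L) (x : ∣ κ ∣ → L) c →
        Σ[ D ∈ Set ℓ ] Small D × Σ[ d ∈ (D → ⊤ ⊎ (∣ κ ∣ × ⊤)) ]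
          (∀ y → (∀ i → _≈[_]_ (discrete (A → L) ⊗ power (discrete L)) (f , x) (d i) y) →
            [ f , x ]′ c ≡ [ proj₁ y , proj₂ y ]′ c)
      value-local f x (inj₁ a) = ⊤ , small-⊤ , const (inj₁ tt) , λ _ e → cong (λ h → h a) (e tt)
      value-local f x (inj₂ i) = ⊤ , small-⊤ , const (inj₂ (i , tt)) , λ _ e → e tt

    -- The homeomorphism `h a` may vary with `a`: as `a` is a discrete coordinate, adding one
    -- coordinate to the small set given by `h a` keeps `a` fixed.
    Σ-absorb : {A : Set ℓ} {B : A → Set ℓ} {S : Space} → (∀ a → S ≅ discrete (B a) ⊗ S) →
               discrete A ⊗ S ≅ discrete (Σ A B) ⊗ S
    Σ-absorb {A} {B} {S} h = record
      { bijection = mk↔ₛ′ (λ (a , x) → let b , y = to (h a) x in (a , b) , y)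
          (λ ((a , b) , y) → a , from (h a) (b , y))
          (λ ((a , b) , y) → cong (λ (b , y) → (a , b) , y) (strictlyInverseˡ (h a) (b , y)))
          (λ (a , x) → cong (a ,_) (strictlyInverseʳ (h a) x))
      ; to-local = λ (a , x) i → let D , sD , d , det = to-local (h a) x i in
          (⊤ ⊎ D) , small-⊤⊎ sD , [ inj₁ , inj₂ ∘ d ]′ , λ (_ , y) e →
            lift-≈ i (e (inj₁ tt)) (det y (e ∘ inj₂))
      ; from-local = λ where
          _ (inj₁ _) → ⊤ , small-⊤ , inj₁ , λ _ e → cong proj₁ (e tt)
          ((a , b) , x) (inj₂ j) → let D , sD , d , det = from-local (h a) (b , x) j in
            (⊤ ⊎ D) , small-⊤⊎ sD , [ inj₁ , d ]′ , λ (_ , y) e →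
              from-≈ d det (e (inj₁ tt)) (e ∘ inj₂)
      }
      where
      lift-≈ : ∀ {a a′ x y} i → a ≡ a′ → _≈[_]_ (discrete (B a) ⊗ S) (to (h a) x) i (to (h a) y) →
               _≈[_]_ (discrete (Σ A B) ⊗ S)
                 ((a , proj₁ (to (h a) x)) , proj₂ (to (h a) x)) i
                 ((a′ , proj₁ (to (h a′) y)) , proj₂ (to (h a′) y))
      lift-≈ (inj₁ _) refl e = cong (_ ,_) e
      lift-≈ (inj₂ _) refl e = e

      lower-≈ : ∀ {a b x y} i → _≈[_]_ (discrete (Σ A B) ⊗ S) ((a , b) , x) i ((a , b) , y) →
                _≈[_]_ (discrete (B a) ⊗ S) (b , x) i (b , y)
      lower-≈ (inj₁ _) _ = refl
      lower-≈ (inj₂ _) e = e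

      from-≈ : ∀ {a b x u y j} {D : Set ℓ} (d : D → ⊤ ⊎ Index S) →
        (∀ v → (∀ i → _≈[_]_ (discrete (B a) ⊗ S) (b , x) (d i) v) →
          _≈[_]_ S (from (h a) (b , x)) j (from (h a) v)) →
        (a , b) ≡ u → (∀ i → _≈[_]_ (discrete (Σ A B) ⊗ S) ((a , b) , x) (d i) (u , y)) →
        _≈[_]_ S (from (h a) (b , x)) j (from (h (proj₁ u)) (proj₂ u , y))
      from-≈ d det refl e = det _ λ i → lower-≈ (d i) (e i)

    -- Back to the bounded topology

    sequences : Set ℓ → Space
    sequences A = power (discrete A)

    -- Each target coordinate below `α` depends on a small set of source coordinates; by regularity
    -- all these sets together lie below one `β`, and the cone of `x` restricted to `β` works.
    local⇒continuous : {A B : Set ℓ} {f : (∣ κ ∣ → A) → ∣ κ ∣ → B} →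
      LocallyDetermined (sequences A) (sequences B) f →
      Continuous (boundedTopology κ A) (boundedTopology κ B) f
    local⇒continuous {f = f} f-local U U-open x fx∈U =
      let (α , s) , fx∈cone , cone⊆U = U-open (f x) fx∈U
          inner = λ (i : ↓ α) → f-local x (proj₁ i , tt)
          β , <β = bounded (small-Σ (small-↓ α) λ i → proj₁ (proj₂ (inner i)))
            λ (i , j) → proj₁ (proj₁ (proj₂ (proj₂ (inner i))) j)
      in (β , x ∘ proj₁) , (λ _ → refl) , λ {y} y∈cone → cone⊆U λ i →
        trans (sym (proj₂ (proj₂ (proj₂ (inner i))) y λ j → sym (y∈cone (_ , <β (i , j)))))
          (fx∈cone i)

    ≅⇒homeomorphic : {A B : Set ℓ} → sequences A ≅ sequences B →
                     Homeomorphic (boundedTopology κ A) (boundedTopology κ B)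
    ≅⇒homeomorphic h = bijection h , local⇒continuous (to-local h) , local⇒continuous (from-local h)

    -- Blocks

    module Blocks (L : Set ℓ) (g : ∣ κ ∣ ↣ L) where

      l₀ : L
      l₀ = ⟦ g ⟧ zero′

      -- If N injects into no initial part of the sum, then the lexicographic order
      -- embeds the sum into N.  Otherwise N ↣ L^{1+C} for a small C, so that the sum
      -- injects into κ × N ↣ L^{1+1+C} ↣ N.
      families↣ : {N : Set ℓ} → Bound L N → (B : ∣ κ ∣ → Set ℓ) → (∀ a → Small (B a)) →
                  Σ ∣ κ ∣ (λ a → B a → L) ↣ N
      families↣ {N} bound B sB with em {∃[ c ] (N ↣ Σ (↓ c) (λ (a , _) → B a → L))}
      ... | no none = lexicographic (λ a → B a → L) N λ c j → none (c , j)
      ... | yes (c , j) = bound (small-⊤⊎ (small-⊤⊎ (small-Σ (small-↓ c) (sB ∘ proj₁))))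
        ⊚ cons↣ g
        ⊚ Σ-map↣ λ a → (cons↣ (g ⊚ ↓↣ ordinal c) ⊚ uncurry↣ l₀ ⊚ j) ⊚ bound (sB a)

      -- Zero outside the image of g.
      width : L → ∣ κ ∣
      width = extend g zero′ id

      Block : Set ℓ
      Block = Σ[ l ∈ L ] (↓ (width l) → L)

      block-ext : {u v : Block} → proj₁ u ≡ proj₁ v →
                  (∀ x p q → proj₂ u (x , p) ≡ proj₂ v (x , q)) → u ≡ v
      block-ext refl e = cong (_ ,_) (ext λ (x , p) → e x p p)

      -- The label `⟦ g ⟧ a` has width `a`, so a function on a set embedded in `↓ a` becomes a block
      -- once padded with `l₀`.
      block-bound : Bound L Block
      block-bound (a , j) = mk↣ {to = ⟦ g ⟧ a ,_} (,-injectiveʳ-UIP uip)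
        ⊚ →-mono (subst (λ b → _ ↣ ↓ b) (sym (extend-to g zero′ id a)) j) l₀

      -- The two extra arguments store `l` and `l′`; `l` is stored because its width alone need not
      -- determine it.
      block×↣ : {N : Set ℓ} → Bound L N → (Block × L) ↣ N
      block×↣ bound = families↣ bound (λ a → ⊤ ⊎ (⊤ ⊎ ↓ a)) (λ a → small-⊤⊎ (small-⊤⊎ (small-↓ a)))
        ⊚ mk↣ {to = encode} λ {u} {v} → encode-injective u v
        where
        encode : Block × L → Σ[ a ∈ ∣ κ ∣ ] (⊤ ⊎ (⊤ ⊎ ↓ a) → L)
        encode ((l , s) , l′) = width l , [ const l , [ const l′ , s ]′ ]′

        encode-injective : ∀ u v → encode u ≡ encode v → u ≡ v
        encode-injective ((l , s) , l′) (_ , _) e with refl ← cong (λ (_ , f) → f (inj₁ tt)) e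
          with e′ ← ,-injectiveʳ-UIP uip e
          with refl ← cong (λ f → f (inj₂ (inj₁ tt))) e′ =
          cong (λ s → (l , s) , l′) (cong (λ f x → f (inj₂ (inj₂ x))) e′)

      block↣ : {N : Set ℓ} → Bound L N → Block ↣ N
      block↣ bound = block×↣ bound ⊚ mk↣ {to = _, l₀} (cong proj₁)

      ↓-mono : ∀ {a b} → a < b → ↓ a ↣ ↓ b
      ↓-mono a<b = ↓-injection ordinal proj₁ (↓-ext ordinal) λ (_ , x<a) → <-trans x<a a<b

      -- By regularity the widths of a small family of blocks have a common bound.
      block-power↣ : {N : Set ℓ} → Bound L N → Bound Block N
      block-power↣ {N} bound {A} sA =
        families↣ bound (λ b → A × (⊤ ⊎ ↓ b)) (λ b → small-Σ sA λ _ → small-⊤⊎ (small-↓ b))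
        ⊚ mk↣ {to = encode} λ {u} {v} → encode-injective u v
        where
        Code : Set ℓ
        Code = Σ[ b ∈ ∣ κ ∣ ] (A × (⊤ ⊎ ↓ b) → L)

        pad : ∀ {b} (u : Block) → width (proj₁ u) < b → ↓ b → L
        pad (l , s) <b = extend (↓-mono <b) l₀ s

        encode : (A → Block) → Code
        encode f = let b , <b = bounded sA (width ∘ proj₁ ∘ f) in
          -- The stored label fixes the length of each sequence, so the padding can be undone.
          b , λ (t , i) → [ const (proj₁ (f t)) , pad (f t) (<b t) ]′ i

        same-value : {u v : Code} → u ≡ v → ∀ t x {p q} →
                     proj₂ u (t , inj₂ (x , p)) ≡ proj₂ v (t , inj₂ (x , q))
        same-value {b , F} refl t x = cong (λ y → F (t , inj₂ y)) (↓-ext ordinal refl)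

        encode-injective : ∀ f f′ → encode f ≡ encode f′ → f ≡ f′
        encode-injective f f′ e = ext λ t → block-ext (cong (λ (_ , F) → F (t , inj₁ tt)) e) λ x p q →
          trans (sym (extend-to (↓-mono _) l₀ (proj₂ (f t)) (x , p)))
            (trans (same-value e t x) (extend-to (↓-mono _) l₀ (proj₂ (f′ t)) (x , q)))

      -- Homeomorphisms of sequence spaces

      split-head : sequences L ≅ discrete L ⊗ sequences L
      split-head =
        sequences L ≅⟨ split small-⊤ (mk↣ {to = const zero′} λ _ → refl) ⟩
        discrete (⊤ → L) ⊗ sequences L
          ≅⟨ ⊗-cong (discrete-cong (mk↔ₛ′ (λ f → f tt) const (λ _ → refl) λ _ → refl)) (sequences L ∎) ⟩
        discrete L ⊗ sequences L ∎

      -- How many coordinates are split off after the head `l` depends on `l`, which is what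
      -- `Σ-absorb` permits.
      split-block : sequences L ≅ discrete Block ⊗ sequences L
      split-block =
        sequences L ≅⟨ split-head ⟩
        discrete L ⊗ sequences L
          ≅⟨ Σ-absorb (λ l → split (small-↓ (width l)) (↓↣ ordinal (width l))) ⟩
        discrete Block ⊗ sequences L ∎

      sequences-≅ : {M : Set ℓ} → (Block × L) ↔ M → sequences L ≅ sequences M
      sequences-≅ {M} b =
        sequences L ≅⟨ ≅-sym (power-power {discrete L}) ⟩
        power (sequences L) ≅⟨ power-cong {sequences L} {discrete Block ⊗ sequences L} split-block ⟩
        power (discrete Block ⊗ sequences L) ≅⟨ power-⊗ {discrete Block} {sequences L} ⟩
        sequences Block ⊗ power (sequences L)
          ≅⟨ ⊗-cong {sequences Block} (sequences Block ∎) (power-power {discrete L}) ⟩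
        sequences Block ⊗ sequences L ≅⟨ ≅-sym (power-⊗ {discrete Block} {discrete L}) ⟩
        power (discrete Block ⊗ discrete L)
          ≅⟨ power-cong {discrete Block ⊗ discrete L} {discrete (Block × L)} discrete-⊗ ⟩
        sequences (Block × L) ≅⟨ power-cong {discrete (Block × L)} {discrete M} (discrete-cong b) ⟩
        sequences M ∎

proposition2p6 : ∀ {ℓ} → ExcludedMiddle ℓ → Extensionality ℓ ℓ →
    (κ Λ : Cardinal ℓ) → Infinite κ → Infinite Λ → κ ≤ᶜ Λ → Regular κ →
    (Σ[ Λ′ ∈ Cardinal ℓ ] IsWeakPower Λ κ Λ′) ×
    ((Λ′ : Cardinal ℓ) → IsWeakPower Λ κ Λ′ →
    IsWeakPower Λ′ κ Λ′ ×
    Homeomorphic (boundedTopology κ ∣ Λ ∣) (boundedTopology κ ∣ Λ′ ∣))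
proposition2p6 {ℓ} em ext κ Λ infinite _ κ≤Λ regular = existence , λ Λ′ isPower →
    idempotent Λ′ isPower , homeomorphic Λ′ isPower
  where
  open Classical em ext
  open Regularity κ infinite regular
  open Blocks ∣ Λ ∣ κ≤Λ

  existence : Σ[ Λ′ ∈ Cardinal ℓ ] IsWeakPower Λ κ Λ′
  existence = let Λ′ , to , from = cardinality Block in
    Λ′ , weakPower {Λ} {Λ′} l₀ (λ sA → to ⊚ block-bound sA) (λ bound → block↣ bound ⊚ from)

  module _ (Λ′ : Cardinal ℓ) (isPower : IsWeakPower Λ κ Λ′) where

    Λ′-bound : Bound ∣ Λ ∣ ∣ Λ′ ∣
    Λ′-bound = weakPower⇒bound {Λ} {Λ′} l₀ isPower

    Λ′↣block : ∣ Λ′ ∣ ↣ Block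
    Λ′↣block = weakPower-minimal {Λ} {Λ′} isPower block-bound

    -- Small powers of `Λ′` embed into those of `Block`, and so into `Λ′`; minimality already
    -- follows from the power with a one-point exponent.
    idempotent : IsWeakPower Λ′ κ Λ′
    idempotent = weakPower {Λ′} {Λ′} (⟦ Λ′-bound small-⊤ ⟧ (const l₀))
      (λ sA → block-power↣ Λ′-bound sA ⊚ ∘-mono Λ′↣block)
      (λ bound → bound small-⊤ ⊚ mk↣ {to = const} (cong λ f → f tt))

    -- `Λ′` injects into `Block` by minimality, and `Block × ∣ Λ ∣` injects into every bound, so
    -- Cantor-Bernstein applies.
    homeomorphic : Homeomorphic (boundedTopology κ ∣ Λ ∣) (boundedTopology κ ∣ Λ′ ∣)
    homeomorphic = ≅⇒homeomorphic (sequences-≅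
      (cantor-bernstein (block×↣ Λ′-bound) (mk↣ {to = _, l₀} (cong proj₁) ⊚ Λ′↣block)))
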